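{- Let $M$ be a set system over a finite set $V$, and let $\varphi$ be any finite sequence of pivot operations $*\{j\}$ and loop complementation operations $+\{j\}$ on elements $j\in V$. Then $M\varphi = M+X*Y+Z$ for some $X,Y,Z\subseteq V$ with $X\subseteq Y$.
   Context: A set system over a finite set $V$ is a pair $M=(V,D)$ with $D$ a family of subsets of $V$. Operations are written postfix and associate to the left: $M\varphi_1\varphi_2\cdots\varphi_n=(\cdots((M\varphi_1)\varphi_2)\cdots)\varphi_n$, and $M+X*Y+Z=((M+X)*Y)+Z$. $\oplus$ denotes symmetric difference of sets (and exclusive-or of truth values). Pivot: for $X\subseteq V$, $M*X=(V,\{Y\oplus X \mid Y\in D\})$. Loop complementation: for $j\in V$, $M+\{j\}=(V,D')$ where for all $Z\subseteq V$: if $j\in Z$, then $Z\in D'$ iff $(Z\in D)\oplus(Z\setminus\{j\}\in D)$; if $j\notin Z$, then $Z\in D'$ iff $Z\in D$. For $X=\{x_1,\dots,x_n\}\subseteq V$, $M+X$ denotes $M+\{x_1\}+\{x_2\}\cdots+\{x_n\}$ (the result does not depend on the order), with $M+\varnothing=M$. -}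

module Defs where

open import Data.Bool.Base using (Bool; _xor_; if_then_else_)
import Data.Bool.Properties as Bool
open import Data.Fin.Base using (Fin)
open import Data.Fin.Subset using (Subset; _-_; ⁅_⁆)
open import Data.Fin.Subset.Properties using (_∈?_; anySubset?)
open import Data.List.Base using (List; allFin; filter; foldl)
open import Data.Nat.Base using (ℕ)
open import Data.Vec.Base using (zipWith)
open import Data.Vec.Properties using (≡-dec)
open import Relation.Binary.PropositionalEquality using (_≡_)
open import Relation.Nullary.Decidable using (does; T?; _×-dec_)

-- A family of subsets of the ground set Fin n, given by its characteristic
-- function.  A predicate Subset n → Set would not do: loop complementation
-- needs the exclusive-or of truth values.
record SetSystem (n : ℕ) : Set where
  constructor setSystem
  field
    D : Subset n → Bool

open SetSystem public

-- Two set systems are equal when they have the same members; this is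
-- stated pointwise because function extensionality is unavailable.
infix 4 _≈_
_≈_ : ∀ {n} → SetSystem n → SetSystem n → Set
M ≈ N = ∀ Z → D M Z ≡ D N Z

infixl 6 _⊕_
_⊕_ : ∀ {n} → Subset n → Subset n → Subset n
_⊕_ = zipWith _xor_

-- _*_ and _+_ share one precedence level and associate to the left, so
-- M + X * Y + Z means ((M + X) * Y) + Z.
infixl 6 _*_ _+_ _+₁_

_*_ : ∀ {n} → SetSystem n → Subset n → SetSystem n
D (M * X) Z =
  does (anySubset? λ Y → T? (D M Y) ×-dec ≡-dec Bool._≟_ (Y ⊕ X) Z)

-- Loop complementation M + {j} on a single element.
_+₁_ : ∀ {n} → SetSystem n → Fin n → SetSystem n
D (M +₁ j) Z =
  if does (j ∈? Z) then D M Z xor D M (Z - j) else D M Z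

-- The elements of X are taken in increasing order.
_+_ : ∀ {n} → SetSystem n → Subset n → SetSystem n
M + X = foldl _+₁_ M (filter (_∈? X) (allFin _))

data Operation (n : ℕ) : Set where
  *⁅_⁆ : Fin n → Operation n
  +⁅_⁆ : Fin n → Operation n

apply : ∀ {n} → SetSystem n → Operation n → SetSystem n
apply M *⁅ j ⁆ = M * ⁅ j ⁆
apply M +⁅ j ⁆ = M +₁ j

applyAll : ∀ {n} → SetSystem n → List (Operation n) → SetSystem n
applyAll = foldl apply

{-# OPTIONS --safe #-}

-- The operations on a single coordinate act on the indicator function of D,
-- seen as a tensor in (GF(2)²)^⊗n, through 2×2 matrices: pivot is the swap
-- [0 1; 1 0] and loop complementation is the transvection [1 0; 1 1].  So Mφ
-- arises from M by a tensor product of invertible 2×2 matrices.  By the Bruhat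
-- decomposition of GL₂(2), each factor is Lᶻ or Lᶻ S Lˣ, where S is the swap
-- and L the transvection; reading the exponents off coordinatewise gives
-- M + X * Y + Z, and X ⊆ Y because Lˣ occurs only next to S.
module Submission where

open import Defs
open import Data.Bool.Base using (Bool; true; false; T; not; _∧_; _xor_; if_then_else_)
open import Data.Bool.Properties using (xor-assoc; xor-same; xor-identityʳ)
import Data.Bool.Properties as Bool
open import Data.Bool.Solver using (module xor-∧-Solver)
open import Data.Fin.Base using (Fin; zero; suc)
open import Data.Fin.Subset using (Subset; _⊆_; _∩_; ⁅_⁆; ⊥)
open import Data.Fin.Subset.Properties using (_∈?_; anySubset?; p∩q⊆p; p─⊥≡p)
open import Data.List.Base using (List; []; _∷_; allFin; filter; foldl; tabulate)
import Data.List.Base as List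
open import Data.List.Properties using (map-tabulate)
open import Data.Nat.Base using (ℕ; suc)
open import Data.Product.Base using (∃-syntax; _×_; _,_)
open import Data.Vec.Base using (Vec; []; _∷_; map; zipWith)
open import Data.Vec.Properties using (≡-dec)
open import Data.Vec.Relation.Unary.All using (All; []; _∷_; universal)
import Data.Vec.Relation.Unary.All as All
open import Data.Vec.Relation.Unary.All.Properties using (map⁺)
open import Function.Base using (_∘_; id)
open import Function.Bundles using (mk⇔)
open import Relation.Binary.PropositionalEquality
  using (_≡_; _≗_; refl; sym; trans; cong; cong₂; subst; module ≡-Reasoning)
open import Relation.Nullary.Decidable using (does; T?; _×-dec_; does-⇔)

open ≡-Reasoning

private variable
  n : ℕ

Family : ℕ → Set
Family n = Subset n → Bool

-- Two-by-two matrices over GF(2) and their Bruhat decomposition.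

record Matrix : Set where
  constructor matrix
  field
    m₀₀ m₀₁ m₁₀ m₁₁ : Bool

open Matrix

entry : Matrix → Bool → Bool → Bool
entry A false false = m₀₀ A
entry A false true  = m₀₁ A
entry A true  false = m₁₀ A
entry A true  true  = m₁₁ A

infixl 7 _·_
_·_ : Matrix → Matrix → Matrix
matrix a b c d · matrix a′ b′ c′ d′ = matrix
  ((a ∧ a′) xor (b ∧ c′)) ((a ∧ b′) xor (b ∧ d′))
  ((c ∧ a′) xor (d ∧ c′)) ((c ∧ b′) xor (d ∧ d′))

entry-· : ∀ A B r c →
  entry (A · B) r c ≡ (entry A r false ∧ entry B false c) xor (entry A r true ∧ entry B true c)
entry-· A B false false = refl
entry-· A B false true  = refl
entry-· A B true  false = refl
entry-· A B true  true  = refl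

identity : Matrix
identity = matrix true false false true

-- The Boolean is an exponent. Here and in `swap`, `false` computes to `identity`, so a subset
-- mapped to matrices acts only at its own elements.
loop : Bool → Matrix
loop x = matrix true false x true

swap : Bool → Matrix
swap y = matrix (not y) y y (not y)

det : Matrix → Bool
det (matrix a b c d) = (a ∧ d) xor (b ∧ c)

det-· : ∀ A B → det (A · B) ≡ det A ∧ det B
det-· (matrix a b c d) (matrix a′ b′ c′ d′) = solve 8
  (λ a b c d a′ b′ c′ d′ →
    (a :* a′ :+ b :* c′) :* (c :* b′ :+ d :* d′) :+
    (a :* b′ :+ b :* d′) :* (c :* a′ :+ d :* c′)
    := (a :* d :+ b :* c) :* (a′ :* d′ :+ b′ :* c′))
  refl a b c d a′ b′ c′ d′
  where open xor-∧-Solver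

Invertible : Matrix → Set
Invertible A = det A ≡ true

·-invertible : ∀ {A B} → Invertible A → Invertible B → Invertible (A · B)
·-invertible {A} {B} p q = trans (det-· A B) (cong₂ _∧_ p q)

swap-invertible : ∀ y → Invertible (swap y)
swap-invertible false = refl
swap-invertible true  = refl

-- `loop z · (swap true · loop x)` has rows x, 1 and 1 + zx, z, so both exponents can be read off
-- its diagonal. An invertible matrix with `m₀₁` false is just `loop m₁₀`.
pivotExponent rightExponent leftExponent : Matrix → Bool
pivotExponent = m₀₁
rightExponent A = m₀₁ A ∧ m₀₀ A
leftExponent A = if m₀₁ A then m₁₁ A else m₁₀ A

bruhat : ∀ A → Invertible A →
  A ≡ loop (leftExponent A) · (swap (pivotExponent A) · loop (rightExponent A))
bruhat (matrix true  false false true)  _ = refl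
bruhat (matrix true  false true  true)  _ = refl
bruhat (matrix true  false c     false) ()
bruhat (matrix false false c     d)     ()
bruhat (matrix false true  true  false) _ = refl
bruhat (matrix false true  true  true)  _ = refl
bruhat (matrix false true  false d)     ()
bruhat (matrix true  true  true  false) _ = refl
bruhat (matrix true  true  false true)  _ = refl
bruhat (matrix true  true  true  true)  ()
bruhat (matrix true  true  false false) ()

-- The right exponents are written as an intersection with the pivot exponents, which makes the
-- inclusion of X in Y immediate.
bruhats : ∀ {As : Vec Matrix n} → All Invertible As →
  As ≡ zipWith _·_ (map loop (map leftExponent As))
         (zipWith _·_ (map swap (map pivotExponent As))
           (map loop (map pivotExponent As ∩ map m₀₀ As)))
bruhats []         = refl
bruhats (px ∷ pxs) = cong₂ _∷_ (bruhat _ px) (bruhats pxs)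

-- Tensor products of matrices acting on indicator functions.

combine : Bool → Bool → Family n → Family n → Family n
combine a b F G W = (a ∧ F W) xor (b ∧ G W)

-- The Kronecker product of `As` applied to `F`: the first coordinate of the argument selects a row
-- of `A`, and the columns weight the two slices of `F`.
act : Vec Matrix n → Family n → Family n
act []       F W       = F W
act (A ∷ As) F (w ∷ W) =
  combine (entry A w false) (entry A w true)
    (act As (F ∘ (false ∷_))) (act As (F ∘ (true ∷_))) W

act-cong : ∀ (As : Vec Matrix n) {F G : Family n} → F ≗ G → act As F ≗ act As G
act-cong []       eq W       = eq W
act-cong (A ∷ As) eq (w ∷ W) =
  cong₂ (λ x y → (entry A w false ∧ x) xor (entry A w true ∧ y))
    (act-cong As (λ V → eq (false ∷ V)) W) (act-cong As (λ V → eq (true ∷ V)) W)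

-- Linearity over GF(2), used to move a matrix at one coordinate past the action on the others.
act-combine : ∀ (As : Vec Matrix n) a b (F G : Family n) →
  act As (combine a b F G) ≗ combine a b (act As F) (act As G)
act-combine []       a b F G W       = refl
act-combine (A ∷ As) a b F G (w ∷ W) = trans
  (cong₂ (λ x y → (entry A w false ∧ x) xor (entry A w true ∧ y))
    (act-combine As a b (F ∘ (false ∷_)) (G ∘ (false ∷_)) W)
    (act-combine As a b (F ∘ (true ∷_)) (G ∘ (true ∷_)) W))
  (solve 8 (λ a b p q f g f′ g′ →
      p :* (a :* f :+ b :* g) :+ q :* (a :* f′ :+ b :* g′)
      := a :* (p :* f :+ q :* f′) :+ b :* (p :* g :+ q :* g′))
    refl a b (entry A w false) (entry A w true)
    (act As (F ∘ (false ∷_)) W) (act As (G ∘ (false ∷_)) W)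
    (act As (F ∘ (true ∷_)) W) (act As (G ∘ (true ∷_)) W))
  where open xor-∧-Solver

-- The mixed-product rule for Kronecker products: linearity pulls the entries of `B` out of
-- `act As`, and regrouping the coefficients gives the entries of `A · B`.
act-· : ∀ (As Bs : Vec Matrix n) F → act As (act Bs F) ≗ act (zipWith _·_ As Bs) F
act-· []       []       F W       = refl
act-· (A ∷ As) (B ∷ Bs) F (w ∷ W) = begin
  (p ∧ act As (act (B ∷ Bs) F ∘ (false ∷_)) W) xor
  (q ∧ act As (act (B ∷ Bs) F ∘ (true ∷_)) W)
    ≡⟨ cong₂ (λ x y → (p ∧ x) xor (q ∧ y)) (slice-act false) (slice-act true) ⟩
  (p ∧ ((entry B false false ∧ f₀) xor (entry B false true ∧ f₁))) xor
  (q ∧ ((entry B true false ∧ f₀) xor (entry B true true ∧ f₁)))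
    ≡⟨ solve 8 (λ p q a b c d f₀ f₁ →
         p :* (a :* f₀ :+ b :* f₁) :+ q :* (c :* f₀ :+ d :* f₁)
         := (p :* a :+ q :* c) :* f₀ :+ (p :* b :+ q :* d) :* f₁)
       refl p q (m₀₀ B) (m₀₁ B) (m₁₀ B) (m₁₁ B) f₀ f₁ ⟩
  (((p ∧ m₀₀ B) xor (q ∧ m₁₀ B)) ∧ f₀) xor (((p ∧ m₀₁ B) xor (q ∧ m₁₁ B)) ∧ f₁)
    ≡⟨ cong₂ (λ x y → (x ∧ f₀) xor (y ∧ f₁)) (entry-· A B w false) (entry-· A B w true) ⟨
  act (zipWith _·_ (A ∷ As) (B ∷ Bs)) F (w ∷ W) ∎
  where
  open xor-∧-Solver
  p = entry A w false
  q = entry A w true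
  f₀ = act (zipWith _·_ As Bs) (F ∘ (false ∷_)) W
  f₁ = act (zipWith _·_ As Bs) (F ∘ (true ∷_)) W
  slice-act : ∀ v → act As (act (B ∷ Bs) F ∘ (v ∷_)) W ≡
    (entry B v false ∧ f₀) xor (entry B v true ∧ f₁)
  slice-act v = trans
    (act-combine As (entry B v false) (entry B v true)
      (act Bs (F ∘ (false ∷_))) (act Bs (F ∘ (true ∷_))) W)
    (cong₂ (λ x y → (entry B v false ∧ x) xor (entry B v true ∧ y))
      (act-· As Bs (F ∘ (false ∷_)) W) (act-· As Bs (F ∘ (true ∷_)) W))

act-identity-∷ : ∀ (As : Vec Matrix n) F w W →
  act (identity ∷ As) F (w ∷ W) ≡ act As (F ∘ (w ∷_)) W
act-identity-∷ As F false W = xor-identityʳ _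
act-identity-∷ As F true  W = refl

act-loop-⊥ : ∀ (F : Family n) → act (map loop ⊥) F ≗ F
act-loop-⊥ F []      = refl
act-loop-⊥ F (w ∷ W) =
  trans (act-identity-∷ (map loop ⊥) F w W) (act-loop-⊥ (F ∘ (w ∷_)) W)

record ActsAs (f : SetSystem n → SetSystem n) (As : Vec Matrix n) : Set where
  constructor actsAs
  field
    D-act : ∀ M → D (f M) ≗ act As (D M)

open ActsAs

ActsAs-∘ : ∀ {f g : SetSystem n → SetSystem n} {As Bs} →
  ActsAs f As → ActsAs g Bs → ActsAs (f ∘ g) (zipWith _·_ As Bs)
D-act (ActsAs-∘ {f = f} {g} {As} {Bs} p q) M W = begin
  D (f (g M)) W                   ≡⟨ D-act p (g M) W ⟩
  act As (D (g M)) W              ≡⟨ act-cong As (D-act q M) W ⟩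
  act As (act Bs (D M)) W         ≡⟨ act-· As Bs (D M) W ⟩
  act (zipWith _·_ As Bs) (D M) W ∎

-- Pivot as a tensor product of swaps.

⊕-cancelʳ : ∀ (Y X : Subset n) → Y ⊕ X ⊕ X ≡ Y
⊕-cancelʳ []      []      = refl
⊕-cancelʳ (y ∷ Y) (x ∷ X) = cong₂ _∷_
  (trans (xor-assoc y x x) (trans (cong (y xor_) (xor-same x)) (xor-identityʳ y)))
  (⊕-cancelʳ Y X)

-- Adding `X` is an involution, so the only candidate in the search is `Z ⊕ X`.
D-* : ∀ (M : SetSystem n) X Z → D (M * X) Z ≡ D M (Z ⊕ X)
D-* M X Z = does-⇔ (mk⇔ to from)
  (anySubset? λ Y → T? (D M Y) ×-dec ≡-dec Bool._≟_ (Y ⊕ X) Z) (T? (D M (Z ⊕ X)))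
  where
  to : ∃[ Y ] (T (D M Y) × Y ⊕ X ≡ Z) → T (D M (Z ⊕ X))
  to (Y , Y∈D , refl) = subst (T ∘ D M) (sym (⊕-cancelʳ Y X)) Y∈D
  from : T (D M (Z ⊕ X)) → ∃[ Y ] (T (D M Y) × Y ⊕ X ≡ Z)
  from Z⊕X∈D = Z ⊕ X , Z⊕X∈D , ⊕-cancelʳ Z X

act-swap : ∀ X (F : Family n) Z → act (map swap X) F Z ≡ F (Z ⊕ X)
act-swap []          F []          = refl
act-swap (false ∷ X) F (z ∷ Z)     = begin
  act (identity ∷ map swap X) F (z ∷ Z) ≡⟨ act-identity-∷ (map swap X) F z Z ⟩
  act (map swap X) (F ∘ (z ∷_)) Z       ≡⟨ act-swap X (F ∘ (z ∷_)) Z ⟩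
  F (z ∷ Z ⊕ X)                         ≡⟨ cong (λ v → F (v ∷ Z ⊕ X)) (xor-identityʳ z) ⟨
  F ((z ∷ Z) ⊕ (false ∷ X))             ∎
act-swap (true ∷ X)  F (false ∷ Z) = act-swap X (F ∘ (true ∷_)) Z
act-swap (true ∷ X)  F (true ∷ Z)  = trans (xor-identityʳ _) (act-swap X (F ∘ (false ∷_)) Z)

*-actsAs : ∀ (X : Subset n) → ActsAs (_* X) (map swap X)
D-act (*-actsAs X) M Z = trans (D-* M X Z) (sym (act-swap X (D M) Z))

-- Loop complementation as a tensor product of transvections.

slice : Bool → SetSystem (suc n) → SetSystem n
slice w M = setSystem (D M ∘ (w ∷_))

slice-+₁-zero : ∀ (M : SetSystem (suc n)) w →
  D (slice w (M +₁ zero)) ≗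
  combine (entry (loop true) w false) (entry (loop true) w true) (D (slice false M)) (D (slice true M))
slice-+₁-zero M false W = sym (xor-identityʳ _)
slice-+₁-zero M true  W = trans
  -- Deleting `zero` leaves the tail `W ─ ⊥`, which is equal to `W` but does not compute to it.
  (cong (λ V → D M (true ∷ W) xor D M (false ∷ V)) (p─⊥≡p W))
  (Bool.xor-comm (D M (true ∷ W)) (D M (false ∷ W)))

+₁-zero-act : ∀ (As : Vec Matrix n) M w W →
  act As (D (slice w (M +₁ zero))) W ≡ act (loop true ∷ As) (D M) (w ∷ W)
+₁-zero-act As M w W = trans
  (act-cong As (slice-+₁-zero M w) W)
  (act-combine As (entry (loop true) w false) (entry (loop true) w true)
    (D (slice false M)) (D (slice true M)) W)

+₁-actsAs : ∀ (j : Fin n) → ActsAs (_+₁ j) (map loop ⁅ j ⁆)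
D-act (+₁-actsAs zero)    M (w ∷ W) =
  trans (sym (act-loop-⊥ (D (slice w (M +₁ zero))) W)) (+₁-zero-act (map loop ⊥) M w W)
-- By computation, `slice w (M +₁ suc j)` is `slice w M +₁ j`.
D-act (+₁-actsAs (suc j)) M (w ∷ W) =
  trans (D-act (+₁-actsAs j) (slice w M) W) (sym (act-identity-∷ (map loop ⁅ j ⁆) (D M) w W))

filter-∈?-map-suc : ∀ x (X : Subset n) js →
  filter (_∈? (x ∷ X)) (List.map suc js) ≡ List.map suc (filter (_∈? X) js)
filter-∈?-map-suc x X []       = refl
filter-∈?-map-suc x X (j ∷ js) with does (j ∈? X)
... | true  = cong (suc j ∷_) (filter-∈?-map-suc x X js)
... | false = filter-∈?-map-suc x X js

slice-foldl-+₁ : ∀ w (M : SetSystem (suc n)) js →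
  slice w (foldl _+₁_ M (List.map suc js)) ≡ foldl _+₁_ (slice w M) js
slice-foldl-+₁ w M []       = refl
slice-foldl-+₁ w M (j ∷ js) = slice-foldl-+₁ w (M +₁ suc j) js

-- `tabulate suc` is what remains of `allFin` after `zero`; once it is written as a mapped list, the
-- fold descends to the slice.
slice-foldl-filter : ∀ w (M : SetSystem (suc n)) x X →
  slice w (foldl _+₁_ M (filter (_∈? (x ∷ X)) (tabulate suc))) ≡ slice w M + X
slice-foldl-filter w M x X = begin
  slice w (foldl _+₁_ M (filter (_∈? (x ∷ X)) (tabulate suc)))
    ≡⟨ cong (λ js → slice w (foldl _+₁_ M (filter (_∈? (x ∷ X)) js))) (map-tabulate id suc) ⟨
  slice w (foldl _+₁_ M (filter (_∈? (x ∷ X)) (List.map suc (allFin _))))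
    ≡⟨ cong (λ js → slice w (foldl _+₁_ M js)) (filter-∈?-map-suc x X (allFin _)) ⟩
  slice w (foldl _+₁_ M (List.map suc (filter (_∈? X) (allFin _))))
    ≡⟨ slice-foldl-+₁ w M (filter (_∈? X) (allFin _)) ⟩
  slice w M + X ∎

+-actsAs : ∀ (X : Subset n) → ActsAs (_+ X) (map loop X)
D-act (+-actsAs [])          M []      = refl
D-act (+-actsAs (false ∷ X)) M (w ∷ W) = begin
  D (M + (false ∷ X)) (w ∷ W)           ≡⟨ cong (λ N → D N W) (slice-foldl-filter w M false X) ⟩
  D (slice w M + X) W                   ≡⟨ D-act (+-actsAs X) (slice w M) W ⟩
  act (map loop X) (D (slice w M)) W    ≡⟨ act-identity-∷ (map loop X) (D M) w W ⟨
  act (map loop (false ∷ X)) (D M) (w ∷ W) ∎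
D-act (+-actsAs (true ∷ X))  M (w ∷ W) = begin
  D (M + (true ∷ X)) (w ∷ W)
    -- The filter keeps `zero` at the head of the list, so the fold over the rest starts from
    -- `M +₁ zero`.
    ≡⟨ cong (λ N → D N W) (slice-foldl-filter w (M +₁ zero) true X) ⟩
  D (slice w (M +₁ zero) + X) W
    ≡⟨ D-act (+-actsAs X) (slice w (M +₁ zero)) W ⟩
  act (map loop X) (D (slice w (M +₁ zero))) W
    ≡⟨ +₁-zero-act (map loop X) M w W ⟩
  act (map loop (true ∷ X)) (D M) (w ∷ W) ∎

-- Sequences of operations and their normal form.

apply-actsAs : ∀ (o : Operation n) → ∃[ As ] (All Invertible As × ActsAs (λ M → apply M o) As)
apply-actsAs *⁅ j ⁆ =
  map swap ⁅ j ⁆ , map⁺ (universal swap-invertible ⁅ j ⁆) , *-actsAs ⁅ j ⁆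
apply-actsAs +⁅ j ⁆ =
  map loop ⁅ j ⁆ , map⁺ (universal (λ _ → refl) ⁅ j ⁆) , +₁-actsAs j

applyAll-actsAs : ∀ (φ : List (Operation n)) →
  ∃[ As ] (All Invertible As × ActsAs (λ M → applyAll M φ) As)
applyAll-actsAs []      =
  map loop ⊥ , map⁺ (universal (λ _ → refl) ⊥) , actsAs λ M W → sym (act-loop-⊥ (D M) W)
applyAll-actsAs (o ∷ φ) with apply-actsAs o | applyAll-actsAs φ
... | Bs , Bs-inv , Bs-acts | As , As-inv , As-acts =
  -- The head of the list is applied first, so its matrices stand on the right.
  zipWith _·_ As Bs ,
  All.zipWith (λ {A} {B} → ·-invertible {A} {B}) As-inv Bs-inv ,
  ActsAs-∘ As-acts Bs-acts

theorem12 : ∀ (n : ℕ) (M : SetSystem n) (φ : List (Operation n)) →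
    ∃[ X ] ∃[ Y ] ∃[ Z ] (X ⊆ Y × applyAll M φ ≈ M + X * Y + Z)
theorem12 n M φ with applyAll-actsAs φ
... | As , As-inv , As-acts = X , Y , Z , p∩q⊆p Y (map m₀₀ As) , λ W → begin
  D (applyAll M φ) W
    ≡⟨ D-act As-acts M W ⟩
  act As (D M) W
    ≡⟨ cong (λ Bs → act Bs (D M) W) (bruhats As-inv) ⟩
  act (zipWith _·_ (map loop Z) (zipWith _·_ (map swap Y) (map loop X))) (D M) W
    -- Postfix operations reverse the matrix order: the rightmost factor comes from `X`, the
    -- leftmost from `Z`.
    ≡⟨ D-act (ActsAs-∘ (+-actsAs Z) (ActsAs-∘ (*-actsAs Y) (+-actsAs X))) M W ⟨
  D (M + X * Y + Z) W ∎
  where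
  Y = map pivotExponent As
  X = Y ∩ map m₀₀ As
  Z = map leftExponent As
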